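{- Let $n$ be a positive integer, let $D$ be a condition on families of subsets of $[n]$, and let $\mathcal{F}\subset 2^{[n]}$ be a family satisfying $D$. Then $|\mathcal{F}|\le S(n,D)$.
   Context: $[n]=\{1,2,\dots,n\}$ and $2^{[n]}$ is the family of all subsets of $[n]$. A condition $D$ is an arbitrary property (predicate) that a family $\mathcal{F}\subset 2^{[n]}$ may or may not satisfy. A full chain is a family $\mathcal{C}=\{A_0,A_1,\dots,A_n\}$ of sets $A_i\in 2^{[n]}$ with $|A_i|=i$ for all $i$ and $A_i\subset A_{i+1}$ for every $0\le i<n$. Let $\mathfrak{C}_n$ denote the set of all $n!$ full chains in $2^{[n]}$. For a family $\mathcal{F}\subset 2^{[n]}$ and a set $G\subset [n]$, let $\omega_{\mathcal{F}}(G)=\binom{n}{|G|}$ if $G\in\mathcal{F}$ and $\omega_{\mathcal{F}}(G)=0$ otherwise. Define $$s(\mathcal{F})=\max_{\mathcal{C}\in\mathfrak{C}_n}\sum_{G\in\mathcal{C}}\omega_{\mathcal{F}}(G),$$ and $$S(n,D)=\max\{s(\mathcal{F}') : \mathcal{F}'\subset 2^{[n]},\ \mathcal{F}' \text{ satisfies } D\}.$$ -}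

module Defs where

open import Data.Bool.Base using (Bool; true; false; if_then_else_)
open import Data.Fin.Base using (Fin; zero; suc; toℕ; inject₁)
import Data.Fin.Properties as Fin
open import Data.Fin.Subset using (Subset; inside; outside; ∣_∣; _⊆_; ⊥)
open import Data.Fin.Subset.Properties using (_⊆?_; ⊆-min; ∣⊥∣≡0; in⊆in)
open import Data.List.Base using (List; []; _∷_; [_]; map; filter; filterᵇ; length; cartesianProductWith)
open import Data.List.Extrema.Nat using (max; xs≤max; argmax-sel)
open import Data.List.Membership.Propositional using (_∈_)
open import Data.List.Membership.Propositional.Properties
  using (∈-cartesianProductWith⁺; ∈-filter⁺; ∈-filter⁻; ∈-map⁺; ∈-map⁻)
import Data.List.Relation.Unary.All as All
open import Data.List.Relation.Unary.Any using (here; there)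
open import Data.Nat.Base using (ℕ; zero; suc; _+_; _≤_; z≤n; s≤s⁻¹)
open import Data.Nat.Combinatorics using (_C_)
open import Data.Nat.Properties
open import Data.Product.Base using (_×_; _,_; proj₁; proj₂; ∃; ∃-syntax)
open import Data.Sum.Base using (inj₁; inj₂)
open import Data.Vec.Base as Vec using (Vec; []; _∷_; lookup)
open import Data.Vec.Properties using (lookup-map)
open import Level using (Level)
open import Relation.Binary.PropositionalEquality using (_≡_; refl; sym; trans; cong; subst₂)
open import Relation.Nullary using (¬_; Dec; yes; no; _×-dec_; contradiction)
open import Relation.Unary using (Pred)

private
  variable
    a ℓ : Level

vectors : {A : Set a} → List A → (k : ℕ) → List (Vec A k)
vectors xs zero    = [ [] ]
vectors xs (suc k) = cartesianProductWith _∷_ xs (vectors xs k)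

subsets : (n : ℕ) → List (Subset n)
subsets n = vectors (inside ∷ outside ∷ []) n

-- A family 𝓕 ⊂ 2^[n], given by its characteristic function.
Family : ℕ → Set
Family n = Subset n → Bool

card : {n : ℕ} → Family n → ℕ
card {n} 𝓕 = length (filterᵇ 𝓕 (subsets n))

-- Non-strict inclusion suffices: the cardinalities make each step strict.
IsFullChain : {n : ℕ} → Vec (Subset n) (suc n) → Set
IsFullChain {n} A =
  (∀ (i : Fin (suc n)) → ∣ lookup A i ∣ ≡ toℕ i) ×
  (∀ (i : Fin n) → lookup A (inject₁ i) ⊆ lookup A (suc i))

isFullChain? : {n : ℕ} (A : Vec (Subset n) (suc n)) → Dec (IsFullChain A)
isFullChain? A =
  Fin.all? (λ i → ∣ lookup A i ∣ ≟ toℕ i) ×-dec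
  Fin.all? (λ i → lookup A (inject₁ i) ⊆? lookup A (suc i))

fullChains : (n : ℕ) → List (Vec (Subset n) (suc n))
fullChains n = filter isFullChain? (vectors (subsets n) (suc n))

ω : {n : ℕ} → Family n → Subset n → ℕ
ω {n} 𝓕 G = if 𝓕 G then n C ∣ G ∣ else 0

-- The members of a full chain are pairwise distinct, so summing over the
-- positions of the vector is summing over the sets in the chain.
chainWeight : {n k : ℕ} → Family n → Vec (Subset n) k → ℕ
chainWeight 𝓕 A = Vec.sum (Vec.map (ω 𝓕) A)

-- The default value 0 plays no role, since full chains exist: see s-isMaximum.
s : {n : ℕ} → Family n → ℕ
s {n} 𝓕 = max 0 (map (chainWeight 𝓕) (fullChains n))

IsMaximum : Pred ℕ ℓ → ℕ → Set ℓ
IsMaximum P m = P m × (∀ k → P k → k ≤ m)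

-- "M = S(n,D)".  This is a relation because for an undecidable D the maximum
-- cannot be computed.  It determines M, and for satisfiable D such an M
-- cannot fail to exist: see IsS-unique and IsS-exists.  D is not required to
-- respect pointwise equality of characteristic functions.
IsS : (n : ℕ) → Pred (Family n) ℓ → ℕ → Set ℓ
IsS n D M = IsMaximum (λ k → ∃[ 𝓕′ ] (D 𝓕′ × k ≡ s 𝓕′)) M

------------------------------------------------------------------------

∈-vectors : {A : Set a} {xs : List A} → (∀ x → x ∈ xs) →
            ∀ {k} (v : Vec A k) → v ∈ vectors xs k
∈-vectors all []      = here refl
∈-vectors all (x ∷ v) = ∈-cartesianProductWith⁺ _∷_ (all x) (∈-vectors all v)

∈-subsets : {n : ℕ} (G : Subset n) → G ∈ subsets n
∈-subsets = ∈-vectors λ { true → here refl ; false → there (here refl) }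

∈-fullChains : {n : ℕ} (A : Vec (Subset n) (suc n)) → IsFullChain A → A ∈ fullChains n
∈-fullChains A p = ∈-filter⁺ isFullChain? (∈-vectors ∈-subsets A) p

fullChain : (n : ℕ) → ∃ (IsFullChain {n})
fullChain zero = ([] ∷ []) , (λ { zero → refl }) , λ ()
fullChain (suc n) with fullChain n
... | A , sizes , steps = ⊥ ∷ Vec.map (inside ∷_) A , sizes′ , steps′
  where
  sizes′ : ∀ i → ∣ lookup (⊥ ∷ Vec.map (inside ∷_) A) i ∣ ≡ toℕ i
  sizes′ zero = ∣⊥∣≡0 (suc n)
  sizes′ (suc i) = trans (cong ∣_∣ (lookup-map i (inside ∷_) A)) (cong suc (sizes i))
  steps′ : ∀ i → lookup (⊥ ∷ Vec.map (inside ∷_) A) (inject₁ i) ⊆ lookup (Vec.map (inside ∷_) A) i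
  steps′ zero = ⊆-min _
  steps′ (suc i) = subst₂ _⊆_ (sym (lookup-map (inject₁ i) (inside ∷_) A))
                              (sym (lookup-map (suc i) (inside ∷_) A)) (in⊆in (steps i))

s-isMaximum : {n : ℕ} (𝓕 : Family n) →
              IsMaximum (λ k → ∃[ A ] (IsFullChain A × k ≡ chainWeight 𝓕 A)) (s 𝓕)
s-isMaximum {n} 𝓕 = attained , λ { _ (A , p , refl) → bound A p }
  where
  bound : ∀ A → IsFullChain A → chainWeight 𝓕 A ≤ s 𝓕
  bound A p = All.lookup (xs≤max 0 _) (∈-map⁺ (chainWeight 𝓕) (∈-fullChains A p))
  attained : ∃[ A ] (IsFullChain A × s 𝓕 ≡ chainWeight 𝓕 A)
  attained with argmax-sel (λ k → k) 0 (map (chainWeight 𝓕) (fullChains n))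
  ... | inj₁ s≡0 = let A , p = fullChain n in
    A , p , ≤-antisym (≤-trans (≤-reflexive s≡0) z≤n) (bound A p)
  ... | inj₂ s∈ with ∈-map⁻ (chainWeight 𝓕) s∈
  ...   | A , A∈ , eq = A , proj₂ (∈-filter⁻ isFullChain? {xs = vectors (subsets n) (suc n)} A∈) , eq

IsS-unique : {n : ℕ} {D : Pred (Family n) ℓ} {M M′ : ℕ} → IsS n D M → IsS n D M′ → M ≡ M′
IsS-unique (p , ub) (p′ , ub′) = ≤-antisym (ub′ _ p) (ub _ p′)

bounded⇒¬¬maximum : {P : Pred ℕ ℓ} {b : ℕ} → ∃ P → (∀ k → P k → k ≤ b) → ¬ ¬ ∃ (IsMaximum P)
bounded⇒¬¬maximum {P = P} {b} (k₀ , p₀) ub none =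
  <-irrefl refl (≤-trans (m≤n+m (suc b) k₀) (climb (suc b) k₀ p₀))
  where
  climb : ∀ j k → P k → k + j ≤ b
  climb zero    k p = ≤-trans (≤-reflexive (+-identityʳ k)) (ub k p)
  climb (suc j) k p with k + suc j ≤? b
  ... | yes le = le
  ... | no ¬le = contradiction (k , p , isMax) none
    where
    b≤k+j : b ≤ k + j
    b≤k+j = s≤s⁻¹ (≤-trans (≰⇒> ¬le) (≤-reflexive (+-suc k j)))
    isMax : ∀ k′ → P k′ → k′ ≤ k
    isMax k′ p′ = +-cancelʳ-≤ j k′ k (≤-trans (climb j k′ p′) b≤k+j)

s≤s-full : {n : ℕ} (𝓕 : Family n) → s 𝓕 ≤ s {n} (λ _ → true)
s≤s-full {n} 𝓕 with proj₁ (s-isMaximum 𝓕)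
... | A , p , eq = ≤-trans (≤-reflexive eq)
  (≤-trans (weight-mono A) (proj₂ (s-isMaximum (λ _ → true)) _ (A , p , refl)))
  where
  ω-mono : ∀ G → ω 𝓕 G ≤ n C ∣ G ∣
  ω-mono G with 𝓕 G
  ... | true  = ≤-refl
  ... | false = z≤n
  weight-mono : ∀ {k} (B : Vec (Subset n) k) → chainWeight 𝓕 B ≤ chainWeight (λ _ → true) B
  weight-mono []      = z≤n
  weight-mono (G ∷ B) = +-mono-≤ (ω-mono G) (weight-mono B)

IsS-exists : {n : ℕ} {D : Pred (Family n) ℓ} → ∃ D → ¬ ¬ ∃ (IsS n D)
IsS-exists (𝓕 , d) =
  bounded⇒¬¬maximum (_ , 𝓕 , d , refl) λ { _ (𝓕′ , _ , refl) → s≤s-full 𝓕′ }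

{-# OPTIONS --safe #-}

-- Double count the pairs (full chain, member of 𝓕 on it): a set of size j lies on
-- j! (n ∸ j)! = n! / (n C j) full chains, so the weights ω summed over all n! chains
-- give n! * card 𝓕, and some chain has weight at least card 𝓕.  The sum over chains is
-- evaluated level by level: total 𝓕 k G sums the weights of the chains from ∅ to a
-- k-set G, and is computed from the totals of the sets covered by G.

module Submission where

open import Defs
open import Data.Bool.Base using (Bool; true; false; if_then_else_)
open import Data.Fin.Base using (Fin; zero; suc; toℕ; inject₁)
open import Data.Fin.Subset using (Subset; inside; outside; ∣_∣; _⊆_; ⊤)
open import Data.Fin.Subset.Properties
  using (∣⊤∣≡n; ∣p∣≡n⇒p≡⊤; ⊆-refl; out⊆; in⊆in)
open import Data.List.Base using (List; []; _∷_; _++_; map; filterᵇ; length)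
open import Data.Nat.Base using (ℕ; NonZero; zero; suc; _+_; _*_; _!; _≤_; z≤n; s≤s)
open import Data.Nat.Combinatorics using (_C_; nCn≡1; nCk+nC[k+1]≡[n+1]C[k+1])
open import Data.Nat.Properties
open import Data.Nat.Solver using (module +-*-Solver)
open import Data.Product.Base using (_×_; _,_; proj₁; proj₂)
open import Data.Vec.Base using (Vec; []; _∷_; lookup)
open import Level using (Level)
open import Relation.Binary.PropositionalEquality
open import Relation.Unary using (Pred)

open +-*-Solver using (solve; _:=_; _:+_; _:*_; con)

private
  variable
    n k m : ℕ

-- Level sums, shadow sums and a binomial identity

-- The sum over all `k`-sets, split by membership of the first element. The recursion is that of
-- Pascal's rule, so binomial coefficients enter by induction.
levelSum : (n k : ℕ) → (Subset n → ℕ) → ℕ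
levelSum zero    zero    f = f []
levelSum zero    (suc k) f = 0
levelSum (suc n) zero    f = levelSum n zero (λ G → f (outside ∷ G))
levelSum (suc n) (suc k) f =
  levelSum n k (λ G → f (inside ∷ G)) + levelSum n (suc k) (λ G → f (outside ∷ G))

-- The sum of f (G ∖ {x}) over x ∈ G.
shadowSum : Subset n → (Subset n → ℕ) → ℕ
shadowSum []            f = 0
shadowSum (inside ∷ G)  f = f (outside ∷ G) + shadowSum G (λ H → f (inside ∷ H))
shadowSum (outside ∷ G) f = shadowSum G (λ H → f (outside ∷ H))

-- Agreement is required on `k`-sets only. This permits replacing `n C ∣ G ∣` by the constant
-- `n C k`, and `G` by `⊤` when `k` is `n`.
levelSum-cong : ∀ n k {f g : Subset n → ℕ} → (∀ G → ∣ G ∣ ≡ k → f G ≡ g G) →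
                levelSum n k f ≡ levelSum n k g
levelSum-cong zero    zero    f≗g = f≗g [] refl
levelSum-cong zero    (suc k) f≗g = refl
levelSum-cong (suc n) zero    f≗g = levelSum-cong n zero (λ G → f≗g (outside ∷ G))
levelSum-cong (suc n) (suc k) f≗g = cong₂ _+_
  (levelSum-cong n k (λ G p → f≗g (inside ∷ G) (cong suc p)))
  (levelSum-cong n (suc k) (λ G → f≗g (outside ∷ G)))

levelSum-+ : ∀ n k (f g : Subset n → ℕ) →
             levelSum n k (λ G → f G + g G) ≡ levelSum n k f + levelSum n k g
levelSum-+ zero    zero    f g = refl
levelSum-+ zero    (suc k) f g = refl
levelSum-+ (suc n) zero    f g = levelSum-+ n zero _ _
levelSum-+ (suc n) (suc k) f g = trans
  (cong₂ _+_ (levelSum-+ n k (λ G → f (inside ∷ G)) _)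
             (levelSum-+ n (suc k) (λ G → f (outside ∷ G)) _))
  (solve 4 (λ a b c d → (a :+ b) :+ (c :+ d) := (a :+ c) :+ (b :+ d)) refl
    (levelSum n k (λ G → f (inside ∷ G))) (levelSum n k (λ G → g (inside ∷ G)))
    (levelSum n (suc k) (λ G → f (outside ∷ G))) (levelSum n (suc k) (λ G → g (outside ∷ G))))

levelSum-*ˡ : ∀ n k c (f : Subset n → ℕ) →
              levelSum n k (λ G → c * f G) ≡ c * levelSum n k f
levelSum-*ˡ zero    zero    c f = refl
levelSum-*ˡ zero    (suc k) c f = sym (*-zeroʳ c)
levelSum-*ˡ (suc n) zero    c f = levelSum-*ˡ n zero c _
levelSum-*ˡ (suc n) (suc k) c f = trans
  (cong₂ _+_ (levelSum-*ˡ n k c _) (levelSum-*ˡ n (suc k) c _))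
  (sym (*-distribˡ-+ c _ _))

levelSum-⊤ : ∀ n (f : Subset n → ℕ) → levelSum n n f ≡ f ⊤
levelSum-⊤ n f = begin
  levelSum n n f              ≡⟨ levelSum-cong n n (λ G p → cong f (∣p∣≡n⇒p≡⊤ p)) ⟩
  levelSum n n (λ _ → f ⊤)    ≡⟨ levelSum-const n n (f ⊤) ⟩
  (n C n) * f ⊤               ≡⟨ cong (_* f ⊤) (nCn≡1 n) ⟩
  1 * f ⊤                     ≡⟨ *-identityˡ (f ⊤) ⟩
  f ⊤                         ∎
  where
  open ≡-Reasoning
  levelSum-const : ∀ n k c → levelSum n k (λ _ → c) ≡ (n C k) * c
  levelSum-const zero    zero    c = sym (*-identityˡ c)
  levelSum-const zero    (suc k) c = refl
  levelSum-const (suc n) zero    c = levelSum-const n zero c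
  levelSum-const (suc n) (suc k) c = trans
    (cong₂ _+_ (levelSum-const n k c) (levelSum-const n (suc k) c))
    (trans (sym (*-distribʳ-+ c (n C k) (n C suc k)))
           (cong (_* c) (nCk+nC[k+1]≡[n+1]C[k+1] n k)))

levelSum-zero-shadowSum : ∀ n (f : Subset n → ℕ) → levelSum n 0 (λ G → shadowSum G f) ≡ 0
levelSum-zero-shadowSum zero    f = refl
levelSum-zero-shadowSum (suc n) f = levelSum-zero-shadowSum n _

-- Every k-set is covered by n ∸ k sets; the subtraction is moved across.
levelSum-shadowSum : ∀ n k (f : Subset n → ℕ) →
  levelSum n (suc k) (λ G → shadowSum G f) + k * levelSum n k f ≡ n * levelSum n k f
levelSum-shadowSum zero    zero    f = refl
levelSum-shadowSum zero    (suc k) f = *-zeroʳ k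
levelSum-shadowSum (suc n) zero    f = begin
  levelSum n 0 (λ G → f (outside ∷ G) + shadowSum G f₁) + X + 0
    ≡⟨ cong (λ t → t + X + 0) (levelSum-+ n 0 f₀ (λ G → shadowSum G f₁)) ⟩
  L + levelSum n 0 (λ G → shadowSum G f₁) + X + 0
    ≡⟨ cong (λ t → L + t + X + 0) (levelSum-zero-shadowSum n f₁) ⟩
  L + 0 + X + 0
    ≡⟨ solve 2 (λ l x → l :+ con 0 :+ x :+ con 0 := l :+ (x :+ con 0)) refl L X ⟩
  L + (X + 0)
    ≡⟨ cong (L +_) (levelSum-shadowSum n 0 f₀) ⟩
  L + n * L ∎
  where
  open ≡-Reasoning
  f₀ f₁ : Subset n → ℕ
  f₀ G = f (outside ∷ G)
  f₁ G = f (inside ∷ G)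
  L X : ℕ
  L = levelSum n 0 f₀
  X = levelSum n 1 (λ G → shadowSum G f₀)
levelSum-shadowSum (suc n) (suc k) f = begin
  levelSum n (suc k) (λ G → f (outside ∷ G) + shadowSum G f₁) + X + suc k * (L₁ + L₀)
    ≡⟨ cong (λ t → t + X + suc k * (L₁ + L₀)) (levelSum-+ n (suc k) f₀ (λ G → shadowSum G f₁)) ⟩
  L₀ + Y + X + suc k * (L₁ + L₀)
    ≡⟨ solve 5 (λ l₀ l₁ x y k → l₀ :+ y :+ x :+ (con 1 :+ k) :* (l₁ :+ l₀)
                 := (l₁ :+ l₀) :+ ((y :+ k :* l₁) :+ (x :+ (con 1 :+ k) :* l₀))) refl L₀ L₁ X Y k ⟩
  (L₁ + L₀) + ((Y + k * L₁) + (X + suc k * L₀))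
    -- One induction hypothesis serves the sets with the first element, the other those without it.
    -- The spare `L₀` comes from deleting the first element, the spare `L₁` from `suc k * L₁`;
    -- together they turn `n` into `suc n`.
    ≡⟨ cong (L₁ + L₀ +_) (cong₂ _+_ (levelSum-shadowSum n k f₁) (levelSum-shadowSum n (suc k) f₀)) ⟩
  (L₁ + L₀) + (n * L₁ + n * L₀)
    ≡⟨ cong (L₁ + L₀ +_) (*-distribˡ-+ n L₁ L₀) ⟨
  suc n * (L₁ + L₀) ∎
  where
  open ≡-Reasoning
  f₀ f₁ : Subset n → ℕ
  f₀ G = f (outside ∷ G)
  f₁ G = f (inside ∷ G)
  L₀ L₁ X Y : ℕ
  L₀ = levelSum n (suc k) f₀
  L₁ = levelSum n k f₁
  X = levelSum n (suc (suc k)) (λ G → shadowSum G f₀)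
  Y = levelSum n (suc k) (λ G → shadowSum G f₁)

-- (k + 1) (n C (k + 1)) = (n ∸ k) (n C k), with the subtraction moved across.
nC[k+1]-absorb : ∀ n k → suc k * (n C suc k) + k * (n C k) ≡ n * (n C k)
nC[k+1]-absorb zero    zero    = refl
nC[k+1]-absorb zero    (suc k) = cong₂ _+_ (*-zeroʳ k) (*-zeroʳ k)
nC[k+1]-absorb (suc n) zero    = begin
  1 * (suc n C 1) + 0          ≡⟨ cong (λ t → 1 * t + 0) (nCk+nC[k+1]≡[n+1]C[k+1] n 0) ⟨
  1 * (1 + (n C 1)) + 0        ≡⟨ solve 1 (λ c → con 1 :* (con 1 :+ c) :+ con 0 := con 1 :+ (con 1 :* c :+ con 0)) refl (n C 1) ⟩
  1 + (1 * (n C 1) + 0)        ≡⟨ cong suc (nC[k+1]-absorb n 0) ⟩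
  suc n * 1                    ∎
  where open ≡-Reasoning
nC[k+1]-absorb (suc n) (suc k) = begin
  suc (suc k) * (suc n C suc (suc k)) + suc k * (suc n C suc k)
    ≡⟨ cong₂ (λ s t → suc (suc k) * s + suc k * t)
         (nCk+nC[k+1]≡[n+1]C[k+1] n (suc k)) (nCk+nC[k+1]≡[n+1]C[k+1] n k) ⟨
  suc (suc k) * (b + c) + suc k * (a + b)
    ≡⟨ solve 4 (λ a b c k → (con 2 :+ k) :* (b :+ c) :+ (con 1 :+ k) :* (a :+ b)
         := (a :+ b) :+ (((con 1 :+ k) :* b :+ k :* a) :+ ((con 2 :+ k) :* c :+ (con 1 :+ k) :* b)))
         refl a b c k ⟩
  (a + b) + ((suc k * b + k * a) + (suc (suc k) * c + suc k * b))
    ≡⟨ cong (a + b +_) (cong₂ _+_ (nC[k+1]-absorb n k) (nC[k+1]-absorb n (suc k))) ⟩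
  (a + b) + (n * a + n * b)
    ≡⟨ cong (a + b +_) (*-distribˡ-+ n a b) ⟨
  suc n * (a + b)
    ≡⟨ cong (suc n *_) (nCk+nC[k+1]≡[n+1]C[k+1] n k) ⟩
  suc n * (suc n C suc k) ∎
  where
  open ≡-Reasoning
  a b c : ℕ
  a = n C k
  b = n C suc k
  c = n C suc (suc k)

-- Cardinality of a family, level by level

χ : Family n → Subset n → ℕ
χ 𝓕 G = if 𝓕 G then 1 else 0

-- The number of members of size at most `k`: chains from ∅ to level `k` meet only these.
card≤ : Family n → ℕ → ℕ
card≤ {n} 𝓕 zero    = levelSum n zero (χ 𝓕)
card≤ {n} 𝓕 (suc k) = card≤ 𝓕 k + levelSum n (suc k) (χ 𝓕)

-- `map f xs ++ ys` is the shape to which the `cartesianProductWith` in `subsets` unfolds.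
length-filterᵇ-++-map : {A B : Set} (p : B → Bool) (f : A → B) (xs : List A) (ys : List B) →
  length (filterᵇ p (map f xs ++ ys)) ≡ length (filterᵇ (λ x → p (f x)) xs) + length (filterᵇ p ys)
length-filterᵇ-++-map p f []       ys = refl
length-filterᵇ-++-map p f (x ∷ xs) ys with p (f x)
... | true  = cong suc (length-filterᵇ-++-map p f xs ys)
... | false = length-filterᵇ-++-map p f xs ys

card-suc : (𝓕 : Family (suc n)) →
           card 𝓕 ≡ card (λ G → 𝓕 (inside ∷ G)) + card (λ G → 𝓕 (outside ∷ G))
card-suc {n} 𝓕 = trans
  (length-filterᵇ-++-map 𝓕 (inside ∷_) (subsets n) _)
  (cong (card (λ G → 𝓕 (inside ∷ G)) +_)
    (trans (length-filterᵇ-++-map 𝓕 (outside ∷_) (subsets n) []) (+-identityʳ _)))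

-- Removing the first element from a set that contains it lowers the size by one, hence the bound
-- `k` there and `suc k` on the other half.
card≤-suc : (𝓕 : Family (suc n)) (k : ℕ) →
  card≤ 𝓕 (suc k) ≡ card≤ (λ G → 𝓕 (inside ∷ G)) k + card≤ (λ G → 𝓕 (outside ∷ G)) (suc k)
card≤-suc {n} 𝓕 zero    =
  solve 3 (λ a b c → a :+ (b :+ c) := b :+ (a :+ c)) refl
    (card≤ (λ G → 𝓕 (outside ∷ G)) 0) (card≤ (λ G → 𝓕 (inside ∷ G)) 0)
    (levelSum n 1 (χ (λ G → 𝓕 (outside ∷ G))))
card≤-suc {n} 𝓕 (suc k) = trans
  (cong (_+ levelSum (suc n) (suc (suc k)) (χ 𝓕)) (card≤-suc 𝓕 k))
  (solve 4 (λ a b c d → (a :+ b) :+ (c :+ d) := (a :+ c) :+ (b :+ d)) refl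
    (card≤ (λ G → 𝓕 (inside ∷ G)) k) (card≤ (λ G → 𝓕 (outside ∷ G)) (suc k)) _ _)

-- The bound `k` is left free above `n` because on the sets without the first element `n` drops
-- while the bound stays.
card≤≡card : (𝓕 : Family n) → n ≤ k → card≤ 𝓕 k ≡ card 𝓕
card≤≡card {zero}  {zero}  𝓕 _ with 𝓕 []
... | true  = refl
... | false = refl
card≤≡card {zero}  {suc k} 𝓕 _ = trans (+-identityʳ _) (card≤≡card {k = k} 𝓕 z≤n)
card≤≡card {suc n} {suc k} 𝓕 (s≤s n≤k) = begin
  card≤ 𝓕 (suc k)
    ≡⟨ card≤-suc 𝓕 k ⟩
  card≤ (λ G → 𝓕 (inside ∷ G)) k + card≤ (λ G → 𝓕 (outside ∷ G)) (suc k)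
    ≡⟨ cong₂ _+_ (card≤≡card _ n≤k) (card≤≡card _ (m≤n⇒m≤1+n n≤k)) ⟩
  card (λ G → 𝓕 (inside ∷ G)) + card (λ G → 𝓕 (outside ∷ G))
    ≡⟨ card-suc 𝓕 ⟨
  card 𝓕 ∎
  where open ≡-Reasoning

-- Total weight of the chains from ∅

-- For a set `G` of size `suc k`, the factor `suc k !` counts the chains from ∅ to `G`, each of
-- which carries `ω 𝓕 G`.
total : Family n → ℕ → Subset n → ℕ
total 𝓕 zero    G = ω 𝓕 G
total 𝓕 (suc k) G = suc k ! * ω 𝓕 G + shadowSum G (total 𝓕 k)

levelSum-ω : (𝓕 : Family n) (k : ℕ) → levelSum n k (ω 𝓕) ≡ (n C k) * levelSum n k (χ 𝓕)
levelSum-ω {n} 𝓕 k = trans (levelSum-cong n k ω≡) (levelSum-*ˡ n k (n C k) (χ 𝓕))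
  where
  ω≡ : ∀ G → ∣ G ∣ ≡ k → ω 𝓕 G ≡ (n C k) * χ 𝓕 G
  ω≡ G refl with 𝓕 G
  ... | true  = sym (*-identityʳ _)
  ... | false = sym (*-zeroʳ (n C k))

-- There are `k ! * (n C k)` chains from ∅ to level `k`. By symmetry they meet all `n C j` sets of a
-- level `j ≤ k` equally often, so the weight `n C j` makes level `j` contribute on average its
-- number of members.
levelSum-total : (𝓕 : Family n) (k : ℕ) →
                 levelSum n k (total 𝓕 k) ≡ k ! * ((n C k) * card≤ 𝓕 k)
levelSum-total 𝓕 zero = trans (levelSum-ω 𝓕 0) (sym (*-identityˡ _))
levelSum-total {n} 𝓕 (suc k) = begin
  levelSum n (suc k) (λ G → suc k ! * ω 𝓕 G + shadowSum G (total 𝓕 k))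
    ≡⟨ levelSum-+ n (suc k) _ _ ⟩
  levelSum n (suc k) (λ G → suc k ! * ω 𝓕 G) + R
    ≡⟨ cong₂ _+_ (trans (levelSum-*ˡ n (suc k) (suc k !) _)
                        (cong (suc k ! *_) (levelSum-ω 𝓕 (suc k)))) shadows ⟩
  suc k ! * (c′ * L) + suc k ! * (c′ * x)
    ≡⟨ solve 4 (λ q c l x → q :* (c :* l) :+ q :* (c :* x) := q :* (c :* (x :+ l))) refl
         (suc k !) c′ L x ⟩
  suc k ! * (c′ * (x + L)) ∎
  where
  open ≡-Reasoning
  c c′ x L R : ℕ
  c = n C k
  c′ = n C suc k
  x = card≤ 𝓕 k
  L = levelSum n (suc k) (χ 𝓕)
  R = levelSum n (suc k) (λ G → shadowSum G (total 𝓕 k))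
  shadows : R ≡ suc k ! * (c′ * x)
  -- The terms moved across in `levelSum-shadowSum` and `nC[k+1]-absorb` both become
  -- `k * (k ! * (c * x))` and cancel; what remains says that the factor `n ∸ k` turns `c` into
  -- `suc k * c′`.
  shadows = +-cancelʳ-≡ (k * (k ! * (c * x))) _ _ (begin
    R + k * (k ! * (c * x))
      ≡⟨ cong (λ t → R + k * t) (levelSum-total 𝓕 k) ⟨
    R + k * levelSum n k (total 𝓕 k)
      ≡⟨ levelSum-shadowSum n k (total 𝓕 k) ⟩
    n * levelSum n k (total 𝓕 k)
      ≡⟨ cong (n *_) (levelSum-total 𝓕 k) ⟩
    n * (k ! * (c * x))
      ≡⟨ solve 4 (λ n q c x → n :* (q :* (c :* x)) := (n :* c) :* (q :* x)) refl n (k !) c x ⟩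
    (n * c) * (k ! * x)
      ≡⟨ cong (_* (k ! * x)) (nC[k+1]-absorb n k) ⟨
    (suc k * c′ + k * c) * (k ! * x)
      ≡⟨ solve 5 (λ k q c c′ x → ((con 1 :+ k) :* c′ :+ k :* c) :* (q :* x)
           := ((con 1 :+ k) :* q) :* (c′ :* x) :+ k :* (q :* (c :* x))) refl k (k !) c c′ x ⟩
    suc k ! * (c′ * x) + k * (k ! * (c * x)) ∎)

total-⊤ : (𝓕 : Family n) → total 𝓕 n ⊤ ≡ n ! * card 𝓕
total-⊤ {n} 𝓕 = begin
  total 𝓕 n ⊤                    ≡⟨ levelSum-⊤ n (total 𝓕 n) ⟨
  levelSum n n (total 𝓕 n)       ≡⟨ levelSum-total 𝓕 n ⟩
  n ! * ((n C n) * card≤ 𝓕 n)    ≡⟨ cong₂ (λ c x → n ! * (c * x)) (nCn≡1 n) (card≤≡card 𝓕 ≤-refl) ⟩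
  n ! * (1 * card 𝓕)             ≡⟨ cong (n ! *_) (*-identityˡ (card 𝓕)) ⟩
  n ! * card 𝓕                   ∎
  where open ≡-Reasoning

-- Upper bound from the heaviest full chain

-- The shadow sum has `∣ G ∣` terms, each at most `b` minus `c`. In `total-bound`, `c` is `k !`
-- times the weight of the chain from `G` upward.
shadowSum-bound : (G : Subset n) (f : Subset n → ℕ) {b c : ℕ} →
  (∀ H → H ⊆ G → suc ∣ H ∣ ≡ ∣ G ∣ → f H + c ≤ b) →
  shadowSum G f + ∣ G ∣ * c ≤ ∣ G ∣ * b
shadowSum-bound []            f         f≤ = z≤n
shadowSum-bound (inside ∷ G)  f {b} {c} f≤ = begin
  f (outside ∷ G) + S + (c + ∣ G ∣ * c)
    ≡⟨ solve 4 (λ x s c d → x :+ s :+ (c :+ d) := (x :+ c) :+ (s :+ d)) refl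
         (f (outside ∷ G)) S c (∣ G ∣ * c) ⟩
  (f (outside ∷ G) + c) + (S + ∣ G ∣ * c)
    ≤⟨ +-mono-≤ (f≤ (outside ∷ G) (out⊆ ⊆-refl) refl)
         (shadowSum-bound G _ (λ H H⊆G p → f≤ (inside ∷ H) (in⊆in H⊆G) (cong suc p))) ⟩
  b + ∣ G ∣ * b ∎
  where
  open ≤-Reasoning
  S : ℕ
  S = shadowSum G (λ H → f (inside ∷ H))
shadowSum-bound (outside ∷ G) f         f≤ =
  shadowSum-bound G _ (λ H H⊆G → f≤ (outside ∷ H) (out⊆ H⊆G))

-- The part of a full chain from level `k` upward; at `k` = 0 and `m` = `n` it unfolds to
-- `IsFullChain`.
IsChainFrom : ℕ → Vec (Subset n) (suc m) → Set
IsChainFrom {m = m} k A =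
  (∀ (i : Fin (suc m)) → ∣ lookup A i ∣ ≡ k + toℕ i) ×
  (∀ (i : Fin m) → lookup A (inject₁ i) ⊆ lookup A (suc i))

IsChainFrom-∷ : {H G : Subset n} {U : Vec (Subset n) m} → H ⊆ G → ∣ H ∣ ≡ k →
                IsChainFrom (suc k) (G ∷ U) → IsChainFrom k (H ∷ G ∷ U)
IsChainFrom-∷ {k = k} H⊆G ∣H∣≡k (sizes , steps) =
  (λ { zero    → trans ∣H∣≡k (sym (+-identityʳ k))
     ; (suc i) → trans (sizes i) (sym (+-suc k (toℕ i))) }) ,
  (λ { zero → H⊆G ; (suc i) → steps i })

-- A bound on all full chains, averaged over the k! ways to continue the chain
-- from G down to ∅.
total-bound : (𝓕 : Family n) {b : ℕ} → (∀ A → IsFullChain A → chainWeight 𝓕 A ≤ b) →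
  (k : ℕ) (G : Subset n) (U : Vec (Subset n) m) → k + m ≡ n → IsChainFrom k (G ∷ U) →
  total 𝓕 k G + k ! * chainWeight 𝓕 U ≤ k ! * b
total-bound 𝓕 {b} weight≤b zero G U refl chain = begin
  ω 𝓕 G + 1 * chainWeight 𝓕 U    ≡⟨ cong (ω 𝓕 G +_) (*-identityˡ _) ⟩
  chainWeight 𝓕 (G ∷ U)          ≤⟨ weight≤b (G ∷ U) chain ⟩
  b                              ≡⟨ *-identityˡ b ⟨
  1 * b                          ∎
  where open ≤-Reasoning
total-bound {n} {m} 𝓕 {b} weight≤b (suc k) G U k+m≡n chain = begin
  suc k ! * w + S + suc k ! * u
    -- The weight `w` of `G` passes to the upper part of the chain, and `suc k !` splits into one
    -- share `k !` for each of the `suc k` sets covered by `G`.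
    ≡⟨ solve 5 (λ k q w u s → (con 1 :+ k) :* q :* w :+ s :+ (con 1 :+ k) :* q :* u
         := s :+ (con 1 :+ k) :* (q :* (w :+ u))) refl k (k !) w u S ⟩
  S + suc k * (k ! * (w + u))
    ≡⟨ cong (λ t → S + t * (k ! * (w + u))) ∣G∣≡ ⟨
  S + ∣ G ∣ * (k ! * (w + u))
    ≤⟨ shadowSum-bound G (total 𝓕 k) (λ H H⊆G p →
         total-bound 𝓕 weight≤b k H (G ∷ U) (trans (+-suc k m) k+m≡n)
           (IsChainFrom-∷ H⊆G (suc-injective (trans p ∣G∣≡)) chain)) ⟩
  ∣ G ∣ * (k ! * b)
    ≡⟨ cong (_* (k ! * b)) ∣G∣≡ ⟩
  suc k * (k ! * b)
    ≡⟨ *-assoc (suc k) (k !) b ⟨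
  suc k ! * b ∎
  where
  open ≤-Reasoning
  w u S : ℕ
  w = ω 𝓕 G
  u = chainWeight 𝓕 U
  S = shadowSum G (total 𝓕 k)
  ∣G∣≡ : ∣ G ∣ ≡ suc k
  ∣G∣≡ = trans (proj₁ chain zero) (+-identityʳ (suc k))

card≤s : (𝓕 : Family n) → card 𝓕 ≤ s 𝓕
card≤s {n} 𝓕 = *-cancelˡ-≤ (n !) {{n !≢0}} (begin
  n ! * card 𝓕            ≡⟨ total-⊤ 𝓕 ⟨
  total 𝓕 n ⊤             ≤⟨ m≤m+n _ _ ⟩
  -- The 0 is the weight of the empty part above `⊤`, where every full chain ends.
  total 𝓕 n ⊤ + n ! * 0   ≤⟨ total-bound 𝓕 (λ A p → proj₂ (s-isMaximum 𝓕) _ (A , p , refl))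
                               n ⊤ [] (+-identityʳ n) chain ⟩
  n ! * s 𝓕               ∎)
  where
  open ≤-Reasoning
  chain : IsChainFrom n (⊤ ∷ [])
  chain = (λ { zero → trans (∣⊤∣≡n n) (sym (+-identityʳ n)) }) , λ ()

theorem2p3 : ∀ {ℓ : Level} (n : ℕ) .{{_ : NonZero n}} (D : Pred (Family n) ℓ)
    (𝓕 : Family n) → D 𝓕 →
    ∀ (M : ℕ) → IsS n D M → card 𝓕 ≤ M
theorem2p3 n D 𝓕 d M (_ , ub) = ≤-trans (card≤s 𝓕) (ub (s 𝓕) (𝓕 , d , refl))
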